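{- For every integer $k \ge 2$, there exists a graph of order $4k+1$ whose Seidel matrix $S$ is singular and such that $S$ has no eigenvector corresponding to the eigenvalue $0$ all of whose entries belong to $\{1,-1\}$ (equivalently, no vector $x\in\{\pm 1\}^{4k+1}$ satisfies $Sx=0$).
   Context: All graphs are simple, undirected, finite, with at least one vertex. The order of a graph is its number of vertices. For a graph $G$ with vertices $v_1,\dots,v_n$ and adjacency matrix $A$, the Seidel matrix of $G$ is the $n\times n$ matrix $S=J_n-I_n-2A$, where $J_n$ is the all-ones matrix and $I_n$ the identity matrix. -}

module Defs where

open import Data.Bool.Base using (Bool; false; if_then_else_)
open import Data.Nat.Base using (ℕ; zero; suc)
open import Data.Fin.Base using (Fin; zero; suc; toℕ; punchIn)
open import Data.Fin.Properties using (_≟_)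
open import Data.Integer.Base using (ℤ; +_; 0ℤ; 1ℤ; -1ℤ; _+_; _-_; _*_; _^_)
open import Data.Integer.Properties using (+-*-semiring)
open import Data.Product.Base using (_×_)
open import Data.Sum.Base using (_⊎_)
open import Data.Vec.Functional using (Vector)
open import Relation.Nullary using (¬_; does)
open import Relation.Binary.PropositionalEquality using (_≡_)
open import Algebra.Properties.Semiring.Sum +-*-semiring using (sum)

record Graph (n : ℕ) : Set where
  field
    adj         : Fin n → Fin n → Bool
    adj-sym     : ∀ i j → adj i j ≡ adj j i
    adj-irrefl  : ∀ i → adj i i ≡ false

open Graph public

-- Seidel matrices and ±1 vectors have integer entries, and whether the
-- determinant or a matrix-vector product vanishes is the same over ℤ and ℝ.
Matrix : ℕ → Set
Matrix n = Fin n → Fin n → ℤ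

allOnes : ∀ n → Matrix n
allOnes n i j = 1ℤ

identity : ∀ n → Matrix n
identity n i j = if does (i ≟ j) then 1ℤ else 0ℤ

adjacencyMatrix : ∀ {n} → Graph n → Matrix n
adjacencyMatrix G i j = if adj G i j then 1ℤ else 0ℤ

seidel : ∀ {n} → Graph n → Matrix n
seidel {n} G i j =
  allOnes n i j - identity n i j - + 2 * adjacencyMatrix G i j

-- Laplace expansion along the first row.
det : ∀ {n} → Matrix n → ℤ
det {zero}  M = 1ℤ
det {suc n} M =
  sum λ j → -1ℤ ^ toℕ j * M zero j * det (λ i l → M (suc i) (punchIn j l))

Singular : ∀ {n} → Matrix n → Set
Singular M = det M ≡ 0ℤ

infixr 7 _*ᵥ_

_*ᵥ_ : ∀ {n} → Matrix n → Vector ℤ n → Vector ℤ n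
(M *ᵥ x) i = sum λ j → M i j * x j

IsEigenvector : ∀ {n} → Matrix n → ℤ → Vector ℤ n → Set
IsEigenvector M μ x = ¬ (∀ i → x i ≡ 0ℤ) × (∀ i → (M *ᵥ x) i ≡ μ * x i)

IsPlusMinusOne : ∀ {n} → Vector ℤ n → Set
IsPlusMinusOne x = ∀ i → x i ≡ 1ℤ ⊎ x i ≡ -1ℤ

{-# OPTIONS --safe #-}
-- The graphs are built so that x, with entry 3 at one vertex v and 1 elsewhere,
-- lies in the kernel of S. Modulo 2, S is J - I, so all entries of an integer
-- kernel vector have the same parity. If y is a ±1 vector in the kernel, this
-- applied to (x - y) / 2 gives y j = - y v for all j ≠ v. Then y v * x + y is a
-- kernel vector supported at v only, which is absurd since the off-diagonal
-- entries of S are ±1.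
--
-- Given such a graph and a ±1 vector r with r · x = 1, join four new vertices to
-- it according to r, - r, r, - r, and let the new vertices induce a path in which
-- the two rows r are the middle vertices. The contributions to the old rows cancel,
-- and the new rows are balanced because Seidel row sums of a path on four vertices
-- are 1 at its ends and -1 in the middle. This is iterated from a graph of order 9.
--
-- For the determinant, the swap of the first two rows is read off the double
-- Laplace expansion, hence a repeated row gives determinant 0, and so does a
-- left kernel vector with nonzero first entry.
module Submission where

open import Defs
open import Data.Nat.Base as ℕ using (ℕ; zero; suc; s≤s)
open import Data.Integer.Base using (ℤ; 0ℤ)
open import Data.Product.Base using (Σ; ∃; _×_; _,_)
open import Data.Vec.Functional using (Vector; _∷_; []; head; tail; removeAt)
open import Data.Bool.Base using (Bool; true; false; not; if_then_else_)
open import Data.Fin.Base using (Fin; zero; suc; toℕ; punchIn; punchOut)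
open import Data.Fin.Patterns
open import Data.Fin.Properties
  using (_≟_; all?; punchInᵢ≢i; punchOut-cong; punchOut-punchIn)
open import Data.Integer.Divisibility.Signed using (_∣_; _∣?_; divides)
open import Data.Integer.Properties as ℤ using (+-*-semiring)
open import Data.Integer.Tactic.RingSolver using (solve-∀)
import Data.Nat.Tactic.RingSolver as ℕ-Solver
open import Data.Sum.Base using (_⊎_; inj₁; inj₂)
open import Algebra.Properties.Semiring.Sum +-*-semiring
open import Function.Base using (_∘_)
open import Relation.Nullary using (¬_; yes; no; does; contradiction)
open import Relation.Nullary.Decidable using (from-yes; from-no)
open import Relation.Binary.PropositionalEquality
open ≡-Reasoning

-- Determinants with a repeated row, and singularity from a left kernel vector.

module Determinant where

  open import Data.Integer.Base using (+_; -_; 1ℤ; -1ℤ; _+_; _*_; _^_)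

  sum-single : ∀ {n} (v : Fin n) {f : Vector ℤ n} →
               (∀ i → i ≢ v → f i ≡ 0ℤ) → sum f ≡ f v
  sum-single {suc n} v {f} f≡0 = begin
    sum f                          ≡⟨ sum-remove f ⟩
    f v + sum (removeAt f v)       ≡⟨ cong (_+_ (f v)) (sum-cong-≗ λ i → f≡0 (punchIn v i) (punchInᵢ≢i v i)) ⟩
    f v + sum {n} (λ _ → 0ℤ)       ≡⟨ cong (_+_ (f v)) (sum-replicate-zero n) ⟩
    f v + 0ℤ                       ≡⟨ ℤ.+-identityʳ (f v) ⟩
    f v                            ∎

  det-cong : ∀ {n} {M N : Matrix n} → (∀ i j → M i j ≡ N i j) → det M ≡ det N
  det-cong {zero}  M≗N = refl
  det-cong {suc n} M≗N = sum-cong-≗ λ j →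
    cong₂ (λ a d → -1ℤ ^ toℕ j * a * d) (M≗N zero j)
      (det-cong λ i l → M≗N (suc i) (punchIn j l))

  -- Both sides list the indices other than `j` and `k` in increasing order.
  punchIn-punchOut-comm : ∀ {n} {j k : Fin (suc (suc n))} (j≢k : j ≢ k) (k≢j : k ≢ j) l →
    punchIn j (punchIn (punchOut j≢k) l) ≡ punchIn k (punchIn (punchOut k≢j) l)
  punchIn-punchOut-comm {j = zero}  {zero}  j≢k _   l = contradiction refl j≢k
  punchIn-punchOut-comm {j = zero}  {suc k} _   _   l = refl
  punchIn-punchOut-comm {j = suc j} {zero}  _   _   l = refl
  punchIn-punchOut-comm {j = suc j} {suc k} _   _   zero    = refl
  punchIn-punchOut-comm {j = suc j} {suc k} j≢k k≢j (suc l) =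
    cong suc (punchIn-punchOut-comm (j≢k ∘ cong suc) (k≢j ∘ cong suc) l)

  -- Removing the smaller index lowers the larger one by one, while removing the larger leaves the
  -- smaller as it is, so the two exponents differ by exactly one.
  punchOut-sign : ∀ {n} {j k : Fin (suc (suc n))} (j≢k : j ≢ k) (k≢j : k ≢ j) →
    -1ℤ ^ toℕ j * -1ℤ ^ toℕ (punchOut j≢k) ≡
    - (-1ℤ ^ toℕ k * -1ℤ ^ toℕ (punchOut k≢j))
  punchOut-sign {j = zero} {zero}  j≢k _ = contradiction refl j≢k
  punchOut-sign {j = zero} {suc k} _ _   = base (-1ℤ ^ toℕ k)
    where
    base : ∀ a → 1ℤ * a ≡ - (-1ℤ * a * 1ℤ)
    base = solve-∀
  punchOut-sign {j = suc j} {zero} _ _   = base (-1ℤ ^ toℕ j)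
    where
    base : ∀ a → -1ℤ * a * 1ℤ ≡ - (1ℤ * a)
    base = solve-∀
  punchOut-sign {zero}  {suc zero} {suc zero} j≢k _ = contradiction refl j≢k
  punchOut-sign {suc n} {suc j} {suc k} j≢k k≢j = begin
    -1ℤ * a * (-1ℤ * b)      ≡⟨ cancel a b ⟩
    a * b                    ≡⟨ punchOut-sign (j≢k ∘ cong suc) (k≢j ∘ cong suc) ⟩
    - (c * d)                ≡⟨ cong -_ (cancel c d) ⟨
    - (-1ℤ * c * (-1ℤ * d))  ∎
    where
    a = -1ℤ ^ toℕ j
    b = -1ℤ ^ toℕ (punchOut (j≢k ∘ cong suc))
    c = -1ℤ ^ toℕ k
    d = -1ℤ ^ toℕ (punchOut (k≢j ∘ cong suc))
    cancel : ∀ x y → -1ℤ * x * (-1ℤ * y) ≡ x * y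
    cancel = solve-∀

  -- The coefficient of u j * w k in det (u ∷ w ∷ R).
  cofactor₂ : ∀ {n} → (Fin n → Vector ℤ (suc (suc n))) → Matrix (suc (suc n))
  cofactor₂ R j k with j ≟ k
  ... | yes _  = 0ℤ
  ... | no j≢k = -1ℤ ^ toℕ j * -1ℤ ^ toℕ (punchOut j≢k)
               * det λ i l → R i (punchIn j (punchIn (punchOut j≢k) l))

  cofactor₂-diag : ∀ {n} (R : Fin n → Vector ℤ (suc (suc n))) j → cofactor₂ R j j ≡ 0ℤ
  cofactor₂-diag R j with j ≟ j
  ... | yes _  = refl
  ... | no j≢j = contradiction refl j≢j

  cofactor₂-punchIn : ∀ {n} (R : Fin n → Vector ℤ (suc (suc n))) j l →
    cofactor₂ R j (punchIn j l) ≡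
    -1ℤ ^ toℕ j * -1ℤ ^ toℕ l * det (λ i m → R i (punchIn j (punchIn l m)))
  cofactor₂-punchIn R j l with j ≟ punchIn j l
  ... | yes j≡jl = contradiction (sym j≡jl) (punchInᵢ≢i j l)
  ... | no  j≢jl = cong
    (λ p → -1ℤ ^ toℕ j * -1ℤ ^ toℕ p * det (λ i m → R i (punchIn j (punchIn p m))))
    (trans (punchOut-cong j refl) (punchOut-punchIn j))

  cofactor₂-antisym : ∀ {n} (R : Fin n → Vector ℤ (suc (suc n))) j k →
    cofactor₂ R j k ≡ - cofactor₂ R k j
  cofactor₂-antisym R j k with j ≟ k | k ≟ j
  ... | yes _   | yes _   = refl
  ... | yes j≡k | no  k≢j = contradiction (sym j≡k) k≢j
  ... | no  j≢k | yes k≡j = contradiction (sym k≡j) j≢k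
  ... | no  j≢k | no  k≢j = begin
    s * det N         ≡⟨ cong₂ _*_ (punchOut-sign j≢k k≢j)
                           (det-cong λ i l → cong (R i) (punchIn-punchOut-comm j≢k k≢j l)) ⟩
    - t * det N′      ≡⟨ ℤ.neg-distribˡ-* t (det N′) ⟨
    - (t * det N′)    ∎
    where
    s = -1ℤ ^ toℕ j * -1ℤ ^ toℕ (punchOut j≢k)
    t = -1ℤ ^ toℕ k * -1ℤ ^ toℕ (punchOut k≢j)
    N  = λ i l → R i (punchIn j (punchIn (punchOut j≢k) l))
    N′ = λ i l → R i (punchIn k (punchIn (punchOut k≢j) l))

  det-expand₂ : ∀ {n} u w (R : Fin n → Vector ℤ (suc (suc n))) →
    det (u ∷ (w ∷ R)) ≡ sum λ j → sum λ k → u j * w k * cofactor₂ R j k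
  det-expand₂ u w R = sum-cong-≗ λ j → let f = λ k → u j * w k * cofactor₂ R j k in begin
    -1ℤ ^ toℕ j * u j * det (λ i l → (w ∷ R) i (punchIn j l))
      ≡⟨ *-distribˡ-sum (-1ℤ ^ toℕ j * u j)
           (λ l → -1ℤ ^ toℕ l * w (punchIn j l) * det λ i m → R i (punchIn j (punchIn l m))) ⟩
    (sum λ l → -1ℤ ^ toℕ j * u j *
      (-1ℤ ^ toℕ l * w (punchIn j l) * det λ i m → R i (punchIn j (punchIn l m))))
      ≡⟨ (sum-cong-≗ λ l → trans
           (regroup (-1ℤ ^ toℕ j) (u j) (-1ℤ ^ toℕ l) (w (punchIn j l)) _)
           (cong (u j * w (punchIn j l) *_) (sym (cofactor₂-punchIn R j l)))) ⟩
    sum (removeAt f j)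
      ≡⟨ ℤ.+-identityˡ _ ⟨
    0ℤ + sum (removeAt f j)
      -- The zero diagonal term is put back, so that the inner sum runs over all columns and can be
      -- exchanged with the outer one in `det-swap`.
      ≡⟨ cong (λ z → z + sum (removeAt f j)) (trans (cong (u j * w j *_) (cofactor₂-diag R j)) (ℤ.*-zeroʳ (u j * w j))) ⟨
    f j + sum (removeAt f j)
      ≡⟨ sum-remove f ⟨
    sum f ∎
    where
    regroup : ∀ s a t b d → s * a * (t * b * d) ≡ a * b * (s * t * d)
    regroup = solve-∀

  sum-neg : ∀ {n} (f : Vector ℤ n) → (sum λ i → - f i) ≡ - sum f
  sum-neg {zero}  f = refl
  sum-neg {suc n} f =
    trans (cong (_+_ (- head f)) (sum-neg (tail f))) (sym (ℤ.neg-distrib-+ (head f) (sum (tail f))))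

  det-swap : ∀ {n} u w (R : Fin n → Vector ℤ (suc (suc n))) →
    det (u ∷ (w ∷ R)) ≡ - det (w ∷ (u ∷ R))
  det-swap u w R = begin
    det (u ∷ (w ∷ R))
      ≡⟨ det-expand₂ u w R ⟩
    (sum λ j → sum λ k → u j * w k * cofactor₂ R j k)
      ≡⟨ ∑-comm (λ j k → u j * w k * cofactor₂ R j k) ⟩
    (sum λ k → sum λ j → u j * w k * cofactor₂ R j k)
      ≡⟨ (sum-cong-≗ λ k → trans
           (sum-cong-≗ λ j → trans
             (cong (u j * w k *_) (cofactor₂-antisym R j k))
             (flip-sign (u j) (w k) (cofactor₂ R k j)))
           (sum-neg λ j → w k * u j * cofactor₂ R k j)) ⟩
    (sum λ k → - sum λ j → w k * u j * cofactor₂ R k j)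
      ≡⟨ sum-neg (λ k → sum λ j → w k * u j * cofactor₂ R k j) ⟩
    - (sum λ k → sum λ j → w k * u j * cofactor₂ R k j)
      ≡⟨ cong -_ (det-expand₂ w u R) ⟨
    - det (w ∷ (u ∷ R)) ∎
    where
    flip-sign : ∀ a b c → a * b * - c ≡ - (b * a * c)
    flip-sign = solve-∀

  -- Negation swaps the constructors on nonzero integers, so only zero survives unification.
  i≡-i⇒i≡0 : ∀ {i} → i ≡ - i → i ≡ 0ℤ
  i≡-i⇒i≡0 {+ zero} _ = refl

  det-repeat : ∀ {n} (R : Fin n → Vector ℤ (suc n)) i → det (R i ∷ R) ≡ 0ℤ
  det-repeat R zero = i≡-i⇒i≡0 (det-swap (head R) (head R) (tail R))
  det-repeat {suc n} R (suc i) = begin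
    det (R (suc i) ∷ R)
      -- With `head R` on top, every minor of the expansion again begins with a row that is repeated
      -- below it, so induction applies.
      ≡⟨ det-swap (R (suc i)) (head R) (tail R) ⟩
    - det (head R ∷ (R (suc i) ∷ tail R))
      ≡⟨ cong -_ (sum-cong-≗ λ j → trans
           (cong (-1ℤ ^ toℕ j * head R j *_) (minor-repeat j))
           (ℤ.*-zeroʳ (-1ℤ ^ toℕ j * head R j))) ⟩
    - (sum {suc (suc n)} λ _ → 0ℤ)
      ≡⟨ cong -_ (sum-replicate-zero (suc (suc n))) ⟩
    0ℤ ∎
    where
    minor : Fin (suc (suc n)) → Fin n → Vector ℤ (suc n)
    minor j a l = R (suc a) (punchIn j l)

    minor-repeat : ∀ j → det (λ a l → (R (suc i) ∷ tail R) a (punchIn j l)) ≡ 0ℤ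
    minor-repeat j = trans
      (det-cong {M = λ a l → (R (suc i) ∷ tail R) a (punchIn j l)} {N = minor j i ∷ minor j}
        λ { zero l → refl ; (suc a) l → refl })
      (det-repeat (minor j) i)

  -- The sum of all `x i * det (M i ∷ tail M)` is evaluated twice: a repeated row kills every term
  -- but `x zero * det M`, and expansion along the first rows collects the entries of `xM`, which
  -- vanish.
  leftKernel⇒singular : ∀ {n} (M : Matrix (suc n)) (x : Vector ℤ (suc n)) →
    x zero ≢ 0ℤ → (∀ j → (sum λ i → x i * M i j) ≡ 0ℤ) → Singular M
  leftKernel⇒singular {n} M x x₀≢0 xM≡0 with ℤ.i*j≡0⇒i≡0∨j≡0 (x zero) {det M} x₀detM≡0
    where
    D : Vector ℤ (suc n)
    D j = det λ i l → M (suc i) (punchIn j l)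

    vanish : ∀ i → i ≢ zero → x i * det (M i ∷ tail M) ≡ 0ℤ
    vanish zero    0≢0 = contradiction refl 0≢0
    vanish (suc i) _   = trans (cong (x (suc i) *_) (det-repeat (tail M) i)) (ℤ.*-zeroʳ (x (suc i)))

    regroup : ∀ a s b d → a * (s * b * d) ≡ s * d * (a * b)
    regroup = solve-∀

    x₀detM≡0 : x zero * det M ≡ 0ℤ
    x₀detM≡0 = begin
      x zero * det M
        ≡⟨ sum-single zero vanish ⟨
      (sum λ i → x i * det (M i ∷ tail M))
        ≡⟨ (sum-cong-≗ λ i → trans
             (*-distribˡ-sum (x i) (λ j → -1ℤ ^ toℕ j * M i j * D j))
             (sum-cong-≗ λ j → regroup (x i) (-1ℤ ^ toℕ j) (M i j) (D j))) ⟩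
      (sum λ i → sum λ j → -1ℤ ^ toℕ j * D j * (x i * M i j))
        ≡⟨ ∑-comm (λ i j → -1ℤ ^ toℕ j * D j * (x i * M i j)) ⟩
      (sum λ j → sum λ i → -1ℤ ^ toℕ j * D j * (x i * M i j))
        ≡⟨ (sum-cong-≗ λ j → trans
             (sym (*-distribˡ-sum (-1ℤ ^ toℕ j * D j) (λ i → x i * M i j)))
             (trans (cong (-1ℤ ^ toℕ j * D j *_) (xM≡0 j)) (ℤ.*-zeroʳ (-1ℤ ^ toℕ j * D j)))) ⟩
      (sum {suc n} λ _ → 0ℤ)
        ≡⟨ sum-replicate-zero (suc n) ⟩
      0ℤ ∎
  ... | inj₁ x₀≡0   = contradiction x₀≡0 x₀≢0
  ... | inj₂ detM≡0 = detM≡0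

-- Kernels of Seidel matrices: linearity and parity.

module SeidelKernel where

  open Determinant
  open import Data.Integer.Base using (+_; -_; 1ℤ; -1ℤ; _+_; _-_; _*_; NonZero)

  InKernel : ∀ {n} → Matrix n → Vector ℤ n → Set
  InKernel M x = ∀ i → (M *ᵥ x) i ≡ 0ℤ

  *ᵥ-linear : ∀ {n} (M : Matrix n) a x b y i →
    (M *ᵥ λ j → a * x j + b * y j) i ≡ a * (M *ᵥ x) i + b * (M *ᵥ y) i
  *ᵥ-linear M a x b y i = begin
    (sum λ j → M i j * (a * x j + b * y j))
      ≡⟨ (sum-cong-≗ λ j → distrib (M i j) a (x j) b (y j)) ⟩
    (sum λ j → a * (M i j * x j) + b * (M i j * y j))
      ≡⟨ ∑-distrib-+ (λ j → a * (M i j * x j)) (λ j → b * (M i j * y j)) ⟩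
    (sum λ j → a * (M i j * x j)) + (sum λ j → b * (M i j * y j))
      ≡⟨ cong₂ _+_ (*-distribˡ-sum a (λ j → M i j * x j)) (*-distribˡ-sum b (λ j → M i j * y j)) ⟨
    a * (M *ᵥ x) i + b * (M *ᵥ y) i ∎
    where
    distrib : ∀ m a x b y → m * (a * x + b * y) ≡ a * (m * x) + b * (m * y)
    distrib = solve-∀

  InKernel-linear : ∀ {n} (M : Matrix n) a x b y → InKernel M x → InKernel M y →
    InKernel M λ j → a * x j + b * y j
  InKernel-linear M a x b y Mx≡0 My≡0 i = begin
    (M *ᵥ λ j → a * x j + b * y j) i  ≡⟨ *ᵥ-linear M a x b y i ⟩
    a * (M *ᵥ x) i + b * (M *ᵥ y) i   ≡⟨ cong₂ (λ p q → a * p + b * q) (Mx≡0 i) (My≡0 i) ⟩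
    a * 0ℤ + b * 0ℤ                   ≡⟨ cong₂ _+_ (ℤ.*-zeroʳ a) (ℤ.*-zeroʳ b) ⟩
    0ℤ                                ∎

  InKernel-cancel : ∀ {n} (M : Matrix n) a .{{_ : NonZero a}} x y → (∀ j → a * x j ≡ y j) →
    InKernel M y → InKernel M x
  InKernel-cancel M a x y ax≡y My≡0 i = ℤ.*-cancelˡ-≡ a ((M *ᵥ x) i) 0ℤ (begin
    a * (M *ᵥ x) i                 ≡⟨ *-distribˡ-sum a (λ j → M i j * x j) ⟩
    (sum λ j → a * (M i j * x j))  ≡⟨ (sum-cong-≗ λ j → trans (exchange a (M i j) (x j)) (cong (M i j *_) (ax≡y j))) ⟩
    (M *ᵥ y) i                     ≡⟨ My≡0 i ⟩
    0ℤ                             ≡⟨ ℤ.*-zeroʳ a ⟨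
    a * 0ℤ                         ∎)
    where
    exchange : ∀ a m x → a * (m * x) ≡ m * (a * x)
    exchange = solve-∀

  -- Taken from `identity`, so that the identity term of `seidel G i j` is `δ j i` by definition.
  δ : ∀ {n} → Fin n → Vector ℤ n
  δ v i = identity _ i v

  δ-eq : ∀ {n} {i v : Fin n} → i ≡ v → δ v i ≡ 1ℤ
  δ-eq {i = i} {v} i≡v with i ≟ v
  ... | yes _  = refl
  ... | no i≢v = contradiction i≡v i≢v

  δ-neq : ∀ {n} {i v : Fin n} → i ≢ v → δ v i ≡ 0ℤ
  δ-neq {i = i} {v} i≢v with i ≟ v
  ... | yes i≡v = contradiction i≡v i≢v
  ... | no _    = refl

  δ-sym : ∀ {n} (i v : Fin n) → δ v i ≡ δ i v
  δ-sym i v with i ≟ v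
  ... | yes i≡v = sym (δ-eq (sym i≡v))
  ... | no i≢v  = sym (δ-neq (i≢v ∘ sym))

  seidel-sym : ∀ {n} (G : Graph n) i j → seidel G i j ≡ seidel G j i
  seidel-sym G i j = cong₂ (λ d a → 1ℤ - d - + 2 * (if a then 1ℤ else 0ℤ)) (δ-sym i j) (adj-sym G i j)

  seidel-offdiag≢0 : ∀ {n} (G : Graph n) {i j} → i ≢ j → seidel G i j ≢ 0ℤ
  seidel-offdiag≢0 G {i} {j} i≢j rewrite δ-neq i≢j with adj G i j
  ... | true  = λ ()
  ... | false = λ ()

  -- Modulo 2 the Seidel matrix is J - I.
  kernel-parity : ∀ {n} (G : Graph n) w → InKernel (seidel G) w → ∀ i j → + 2 ∣ w i - w j
  kernel-parity G w Sw≡0 i j = divides (A j - A i) (begin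
    w i - w j
      ≡⟨ rearrange (sum w) (w i) (w j) ⟩
    (sum w - w j) - (sum w - w i)
      ≡⟨ cong₂ _-_ (row j) (row i) ⟩
    + 2 * A j - + 2 * A i
      ≡⟨ factor (A j) (A i) ⟩
    (A j - A i) * + 2 ∎)
    where
    A : Vector ℤ _
    A i = (adjacencyMatrix G *ᵥ w) i

    rearrange : ∀ s p q → p - q ≡ (s - q) - (s - p)
    rearrange = solve-∀

    factor : ∀ p q → + 2 * p - + 2 * q ≡ (p - q) * + 2
    factor = solve-∀

    split : ∀ d a w → w ≡ (1ℤ - d - + 2 * a) * w + (d * w + + 2 * (a * w))
    split = solve-∀

    δ-row : ∀ i → (sum λ j → δ j i * w j) ≡ w i
    δ-row i = begin
      (sum λ j → δ j i * w j)
        ≡⟨ sum-single i (λ j j≢i → cong (_* w j) (δ-neq (j≢i ∘ sym))) ⟩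
      δ i i * w i
        ≡⟨ cong (_* w i) (δ-eq {i = i} refl) ⟩
      1ℤ * w i
        ≡⟨ ℤ.*-identityˡ (w i) ⟩
      w i ∎

    -- Row `i` of `J = S + I + 2A` applied to `w`, where the `S` part vanishes. The left side does
    -- not depend on `i`, so two rows can be compared.
    sum-split : ∀ i → sum w ≡ 0ℤ + (w i + + 2 * A i)
    sum-split i = begin
      sum w
        ≡⟨ (sum-cong-≗ λ j → split (δ j i) (adjacencyMatrix G i j) (w j)) ⟩
      (sum λ j → seidel G i j * w j + (δ j i * w j + + 2 * (adjacencyMatrix G i j * w j)))
        ≡⟨ ∑-distrib-+ (λ j → seidel G i j * w j)
             (λ j → δ j i * w j + + 2 * (adjacencyMatrix G i j * w j)) ⟩
      (seidel G *ᵥ w) i + (sum λ j → δ j i * w j + + 2 * (adjacencyMatrix G i j * w j))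
        ≡⟨ cong₂ _+_ (Sw≡0 i) (trans
             (∑-distrib-+ (λ j → δ j i * w j) (λ j → + 2 * (adjacencyMatrix G i j * w j)))
             (cong₂ _+_ (δ-row i) (sym (*-distribˡ-sum (+ 2) (λ j → adjacencyMatrix G i j * w j))))) ⟩
      0ℤ + (w i + + 2 * A i) ∎

    row : ∀ i → sum w - w i ≡ + 2 * A i
    row i = trans (cong (λ s → s - w i) (sum-split i)) (cancel (w i) (A i))
      where
      cancel : ∀ p a → 0ℤ + (p + + 2 * a) - p ≡ + 2 * a
      cancel = solve-∀

  -- The vector with entry 3 at one vertex: singularity and exclusion of ±1 kernel vectors.

  weight : ∀ {n} → Fin n → Vector ℤ n
  weight v i = 1ℤ + + 2 * δ v i

  weight≢0 : ∀ {n} (v i : Fin n) → weight v i ≢ 0ℤ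
  weight≢0 v i with does (i ≟ v)
  ... | true  = λ ()
  ... | false = λ ()

  -- Symmetry of `seidel G` turns the kernel vector into a left kernel vector, and its first entry
  -- is 1 or 3 wherever `v` lies.
  weightKernel⇒singular : ∀ {n} (G : Graph (suc n)) v →
    InKernel (seidel G) (weight v) → Singular (seidel G)
  weightKernel⇒singular G v Sx≡0 =
    leftKernel⇒singular (seidel G) (weight v) (weight≢0 v zero) λ j → begin
      (sum λ i → weight v i * seidel G i j)
        ≡⟨ (sum-cong-≗ λ i → trans (ℤ.*-comm (weight v i) (seidel G i j))
             (cong (_* weight v i) (seidel-sym G i j))) ⟩
      (seidel G *ᵥ weight v) j
        ≡⟨ Sx≡0 j ⟩
      0ℤ ∎

  ±1-alternatives : ∀ {p q} → p ≡ 1ℤ ⊎ p ≡ -1ℤ → q ≡ 1ℤ ⊎ q ≡ -1ℤ → p ≡ q ⊎ p + q ≡ 0ℤ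
  ±1-alternatives (inj₁ refl) (inj₁ refl) = inj₁ refl
  ±1-alternatives (inj₁ refl) (inj₂ refl) = inj₂ refl
  ±1-alternatives (inj₂ refl) (inj₁ refl) = inj₂ refl
  ±1-alternatives (inj₂ refl) (inj₂ refl) = inj₁ refl

  -- Order at least 2 is essential: the contradiction reads a row other than `v`, and for one vertex
  -- `S` is zero.
  weightKernel⇒no±1Kernel : ∀ {n} (G : Graph (suc (suc n))) v → InKernel (seidel G) (weight v) →
    ∀ {y} → InKernel (seidel G) y → ¬ IsPlusMinusOne y
  weightKernel⇒no±1Kernel {n} G v Sx≡0 {y} Sy≡0 y±1 = S≢0 (±4≢0 (y±1 v) column)
    where
    S : Matrix (suc (suc n))
    S = seidel G

    -- This is `(1 - p) / 2` without division; it makes `w` the integer vector `(weight v - y) / 2`.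
    half : ∀ {p} → p ≡ 1ℤ ⊎ p ≡ -1ℤ → ℤ
    half (inj₁ _) = 0ℤ
    half (inj₂ _) = 1ℤ

    2half : ∀ {p} (p±1 : p ≡ 1ℤ ⊎ p ≡ -1ℤ) → + 2 * half p±1 ≡ 1ℤ - p
    2half (inj₁ refl) = refl
    2half (inj₂ refl) = refl

    half-cong : ∀ {p q} (p±1 : p ≡ 1ℤ ⊎ p ≡ -1ℤ) (q±1 : q ≡ 1ℤ ⊎ q ≡ -1ℤ) →
      p ≡ q → half p±1 ≡ half q±1
    half-cong (inj₁ refl) (inj₁ refl) _ = refl
    half-cong (inj₁ refl) (inj₂ refl) ()
    half-cong (inj₂ refl) (inj₁ refl) ()
    half-cong (inj₂ refl) (inj₂ refl) _ = refl

    w : Vector ℤ (suc (suc n))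
    w j = δ v j + half (y±1 j)

    2w≡x-y : ∀ j → + 2 * w j ≡ 1ℤ * weight v j + -1ℤ * y j
    2w≡x-y j = begin
      + 2 * (δ v j + half (y±1 j))            ≡⟨ ℤ.*-distribˡ-+ (+ 2) (δ v j) (half (y±1 j)) ⟩
      + 2 * δ v j + + 2 * half (y±1 j)        ≡⟨ cong (λ h → + 2 * δ v j + h) (2half (y±1 j)) ⟩
      + 2 * δ v j + (1ℤ - y j)                ≡⟨ regroup (δ v j) (y j) ⟩
      1ℤ * weight v j + -1ℤ * y j             ∎
      where
      regroup : ∀ d p → + 2 * d + (1ℤ - p) ≡ 1ℤ * (1ℤ + + 2 * d) + -1ℤ * p
      regroup = solve-∀

    Sw≡0 : InKernel S w
    Sw≡0 = InKernel-cancel S (+ 2) w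
           (λ j → 1ℤ * weight v j + -1ℤ * y j) 2w≡x-y (InKernel-linear S 1ℤ (weight v) -1ℤ y Sx≡0 Sy≡0)

    opposite : ∀ j → j ≢ v → y v + y j ≡ 0ℤ
    opposite j j≢v with ±1-alternatives (y±1 v) (y±1 j)
    ... | inj₂ eq = eq
    -- If `y v` and `y j` agree, their halves cancel and `w v - w j` is 1, which is odd.
    ... | inj₁ eq = contradiction (subst (+ 2 ∣_) diff≡1 (kernel-parity G w Sw≡0 v j))
                      (from-no (+ 2 ∣? 1ℤ))
      where
      cancel : ∀ h → (1ℤ + h) - (0ℤ + h) ≡ 1ℤ
      cancel = solve-∀
      diff≡1 : w v - w j ≡ 1ℤ
      diff≡1 = begin
        (δ v v + half (y±1 v)) - (δ v j + half (y±1 j))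
          ≡⟨ cong₂ _-_ (cong (_+ half (y±1 v)) (δ-eq {i = v} refl))
               (cong₂ _+_ (δ-neq j≢v) (sym (half-cong (y±1 v) (y±1 j) eq))) ⟩
        (1ℤ + half (y±1 v)) - (0ℤ + half (y±1 v))
          ≡⟨ cancel (half (y±1 v)) ⟩
        1ℤ ∎

    u : Vector ℤ (suc (suc n))
    u j = y v * weight v j + 1ℤ * y j

    u-off : ∀ j → j ≢ v → u j ≡ 0ℤ
    u-off j j≢v = trans (cong (λ d → y v * (1ℤ + + 2 * d) + 1ℤ * y j) (δ-neq j≢v))
      (trans (simplify (y v) (y j)) (opposite j j≢v))
      where
      simplify : ∀ p q → p * (1ℤ + + 2 * 0ℤ) + 1ℤ * q ≡ p + q
      simplify = solve-∀

    u-v : u v ≡ + 4 * y v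
    u-v = trans (cong (λ d → y v * (1ℤ + + 2 * d) + 1ℤ * y v) (δ-eq {i = v} refl)) (simplify (y v))
      where
      simplify : ∀ p → p * (1ℤ + + 2 * 1ℤ) + 1ℤ * p ≡ + 4 * p
      simplify = solve-∀

    -- Any vertex other than `v` would do: as `u` is supported at `v`, this row isolates one
    -- off-diagonal entry times `4 * y v`.
    i₀ : Fin (suc (suc n))
    i₀ = punchIn v zero

    column : S i₀ v * (+ 4 * y v) ≡ 0ℤ
    column = begin
      S i₀ v * (+ 4 * y v)  ≡⟨ cong (S i₀ v *_) u-v ⟨
      S i₀ v * u v          ≡⟨ sum-single v (λ j j≢v → trans (cong (S i₀ j *_) (u-off j j≢v)) (ℤ.*-zeroʳ (S i₀ j))) ⟨
      (S *ᵥ u) i₀           ≡⟨ InKernel-linear S (y v) (weight v) 1ℤ y Sx≡0 Sy≡0 i₀ ⟩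
      0ℤ                    ∎

    ±4≢0 : ∀ {s p} → p ≡ 1ℤ ⊎ p ≡ -1ℤ → s * (+ 4 * p) ≡ 0ℤ → s ≡ 0ℤ
    ±4≢0 {s} p±1 eq with ℤ.i*j≡0⇒i≡0∨j≡0 s eq
    ... | inj₁ s≡0 = s≡0
    ±4≢0 (inj₁ refl) _ | inj₂ ()
    ±4≢0 (inj₂ refl) _ | inj₂ ()

    S≢0 : S i₀ v ≢ 0ℤ
    S≢0 = seidel-offdiag≢0 G (punchInᵢ≢i v zero)

  -- Extending a graph by four vertices.

  addVertex : ∀ {n} → Graph n → (Fin n → Bool) → Graph (suc n)
  addVertex G r .adj zero    zero    = false
  addVertex G r .adj zero    (suc j) = r j
  addVertex G r .adj (suc i) zero    = r i
  addVertex G r .adj (suc i) (suc j) = adj G i j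
  addVertex G r .adj-sym zero    zero    = refl
  addVertex G r .adj-sym zero    (suc j) = refl
  addVertex G r .adj-sym (suc i) zero    = refl
  addVertex G r .adj-sym (suc i) (suc j) = adj-sym G i j
  addVertex G r .adj-irrefl zero    = refl
  addVertex G r .adj-irrefl (suc i) = adj-irrefl G i

  -- The off-diagonal Seidel entry for adjacency `b`, left unsimplified so that it agrees with
  -- `seidel` by computation.
  sgn : Bool → ℤ
  sgn b = 1ℤ - 0ℤ - + 2 * (if b then 1ℤ else 0ℤ)

  -- The invariant of the iteration. The ±1 vector `r` is stored as the adjacency row `signs`, with
  -- `true` for -1.
  record Core (n : ℕ) : Set where
    field
      graph  : Graph n
      apex   : Fin n
      kernel : InKernel (seidel graph) (weight apex)
      signs  : Fin n → Bool
      signed-sum : (sum λ j → sgn (signs j) * weight apex j) ≡ 1ℤ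

  sgn-not-sum : ∀ {n} (r : Fin n → Bool) (x : Vector ℤ n) →
    (sum λ j → sgn (not (r j)) * x j) ≡ - (sum λ j → sgn (r j) * x j)
  sgn-not-sum r x = trans (sum-cong-≗ λ j → flip-sign (r j) (x j)) (sum-neg λ j → sgn (r j) * x j)
    where
    flip-sign : ∀ b p → sgn (not b) * p ≡ - (sgn b * p)
    flip-sign true  p = trans (ℤ.*-identityˡ p) (sym (trans (cong -_ (ℤ.-1*i≡-i p)) (ℤ.neg-involutive p)))
    flip-sign false p = trans (ℤ.-1*i≡-i p) (cong -_ (sym (ℤ.*-identityˡ p)))

  extend : ∀ {n} → Core n → Core (suc (suc (suc (suc n))))
  extend {n} C = record
    { graph = G⁺ ; apex = suc (suc (suc (suc apex))) ; kernel = kernel⁺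
    -- The new entries 1, -1, 1, -1 meet weights 1 and cancel, so the signed sum stays 1.
    ; signs = false ∷ true ∷ false ∷ true ∷ signs
    ; signed-sum = cong (λ s → 1ℤ + (-1ℤ + (1ℤ + (-1ℤ + s)))) signed-sum
    }
    where
    open Core C
    r̄ : Fin n → Bool
    r̄ = not ∘ signs

    r̄-sum : (sum λ j → sgn (r̄ j) * weight apex j) ≡ -1ℤ
    r̄-sum = trans (sgn-not-sum signs (weight apex)) (cong -_ signed-sum)

    -- The new vertices form the path 2 - 3 - 1 - 0.
    G⁺ : Graph (suc (suc (suc (suc n))))
    G⁺ = addVertex (addVertex (addVertex (addVertex graph signs)
           (true ∷ r̄)) (false ∷ true ∷ signs)) (true ∷ false ∷ false ∷ r̄)

    kernel⁺ : InKernel (seidel G⁺) (weight (suc (suc (suc (suc apex)))))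
    -- In these four rows the numerals are the Seidel row of the path, all new weights being 1, and
    -- `s` is the contribution of the old vertices.
    kernel⁺ 0F = cong (λ s → 0ℤ + (-1ℤ + (1ℤ + (1ℤ + s)))) r̄-sum
    kernel⁺ 1F = cong (λ s → -1ℤ + (0ℤ + (1ℤ + (-1ℤ + s)))) signed-sum
    kernel⁺ 2F = cong (λ s → 1ℤ + (1ℤ + (0ℤ + (-1ℤ + s)))) r̄-sum
    kernel⁺ 3F = cong (λ s → 1ℤ + (-1ℤ + (-1ℤ + (0ℤ + s)))) signed-sum
    -- Fixing `signs i` lets the four new entries compute; the rest of the row is the old row `i` by
    -- definition.
    kernel⁺ (suc (suc (suc (suc i)))) with signs i
    ... | true  = cong (λ s → 1ℤ + (-1ℤ + (1ℤ + (-1ℤ + s)))) (kernel i)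
    ... | false = cong (λ s → -1ℤ + (1ℤ + (-1ℤ + (1ℤ + s)))) (kernel i)

  -- The graph of order 9 and the iteration.

  empty : Graph 0
  empty .adj ()
  empty .adj-sym ()
  empty .adj-irrefl ()

  pattern ● = true
  pattern ○ = false

  -- A coclique {0,1,2,3}, a clique {4,5,6,7} and the apex 8, which is adjacent to
  -- the coclique only; clique and coclique are joined between equal parities.
  graph₉ : Graph 9
  graph₉ =
    addVertex (addVertex (addVertex (addVertex
    (addVertex (addVertex (addVertex (addVertex
    (addVertex empty []) (○ ∷ []))
      (● ∷ ○ ∷ []))
      (● ∷ ● ∷ ○ ∷ []))
      (● ∷ ● ∷ ● ∷ ○ ∷ []))
      (○ ∷ ● ∷ ○ ∷ ● ∷ ● ∷ []))
      (○ ∷ ● ∷ ○ ∷ ● ∷ ○ ∷ ● ∷ []))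
      (○ ∷ ○ ∷ ○ ∷ ● ∷ ○ ∷ ● ∷ ● ∷ []))
      (○ ∷ ○ ∷ ○ ∷ ● ∷ ○ ∷ ● ∷ ○ ∷ ● ∷ [])

  core₉ : Core 9
  core₉ = record
    { graph      = graph₉
    ; apex       = 8F
    -- Decided by computation. In a row other than that of the apex, the three other members of the
    -- same clique or coclique offset the apex entry 3, and the four vertices of the other side
    -- cancel.
    ; kernel     = from-yes (all? λ i → (seidel graph₉ *ᵥ weight 8F) i ℤ.≟ 0ℤ)
    -- Five entries -1, three entries 1, and 1 at the apex of weight 3: -5 + 3 + 3 = 1.
    ; signs      = true ∷ true ∷ true ∷ true ∷ true ∷ false ∷ false ∷ false ∷ false ∷ []
    ; signed-sum = refl
    }

  -- With the order in this form, a step `suc k` adds four successors by computation, and the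
  -- leading 2 fits `core⇒example`.
  core : ∀ k → Core (2 ℕ.+ (k ℕ.* 4 ℕ.+ 7))
  core zero    = core₉
  core (suc k) = extend (core k)

  HasExample : ℕ → Set
  HasExample n = Σ (Graph n) λ G → Singular (seidel G) ×
    ¬ ∃ λ (x : Vector ℤ n) → IsEigenvector (seidel G) 0ℤ x × IsPlusMinusOne x

  core⇒example : ∀ {n} → Core (suc (suc n)) → HasExample (suc (suc n))
  core⇒example C = graph , weightKernel⇒singular graph apex kernel ,
    λ { (y , (_ , Sy≡0y) , y±1) →
        weightKernel⇒no±1Kernel graph apex kernel (λ i → trans (Sy≡0y i) (ℤ.*-zeroˡ (y i))) y±1 }
    where open Core C

open SeidelKernel using (core; core⇒example; HasExample)
open import Data.Nat.Base using (_+_; _*_; _≤_)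

theorem4p1 : ∀ (k : ℕ) → 2 ≤ k →
    Σ (Graph (4 * k + 1)) λ G →
    Singular (seidel G) ×
    ¬ (∃ λ (x : Vector ℤ (4 * k + 1)) →
    IsEigenvector (seidel G) 0ℤ x × IsPlusMinusOne x)
theorem4p1 (suc zero)    (s≤s ())
-- The inner `k` counts the extensions made from order 9, which is the case of parameter 2.
theorem4p1 (suc (suc k)) _ = subst HasExample (order k) (core⇒example (core k))
  where
  order : ∀ k → 2 + (k * 4 + 7) ≡ 4 * (2 + k) + 1
  order = ℕ-Solver.solve-∀
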